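{- Let $\mathbb{A}_1,\ldots,\mathbb{A}_n,\mathbb{B}$ be sized CPOs with sets of maximal elements $A_1,\ldots,A_n,B$ and size ordinals $\zeta_{\mathbb{A}_1},\ldots,\zeta_{\mathbb{A}_n},\zeta_{\mathbb{B}}$, and let $A=A_1\times\cdots\times A_n$. Let $h:A_1\times\cdots\times A_n\times B^m\to B$ and $g_i:A\to A$ ($i=1,\ldots,m$) with $g_i(x_1,\ldots,x_n)=\langle g_i^1(x_1,\ldots,x_n),\ldots,g_i^n(x_1,\ldots,x_n)\rangle$, where $g_i^j:A\to A_j$. Let $\eta_h$ be a production function for $h$ and $\eta_{i,j}$ a production function for $g_i^j$ ($i=1,\ldots,m$, $j=1,\ldots,n$). Assume that $\eta_h(\zeta_{\mathbb{A}_1},\ldots,\zeta_{\mathbb{A}_n},\beta_1,\ldots,\beta_m)>\min_{i=1,\ldots,m}\beta_i$ for all $\beta_1,\ldots,\beta_m\le\zeta_{\mathbb{B}}$ with $\beta_i<\zeta_{\mathbb{B}}$ for some $i$. If $f:A\to B$ is a function defined by corecursion from $h$ and $g_1,\ldots,g_m$, then there exists a production function $\eta_f$ for $f$ satisfying, for all $\bar\alpha\in\mathrm{On}(\zeta_{\mathbb{A}_1})\times\cdots\times\mathrm{On}(\zeta_{\mathbb{A}_n})$, $$\eta_f(\bar\alpha)=\eta_h\big(\bar\alpha,\ \eta_f(\eta_{1,1}(\bar\alpha),\ldots,\eta_{1,n}(\bar\alpha)),\ \ldots,\ \eta_f(\eta_{m,1}(\bar\alpha),\ldots,\eta_{m,n}(\bar\alpha))\big).$$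 Moreover, if $\eta_h$ and all $\eta_{i,j}$ are continuous, then so is $\eta_f$.
   Context: A CPO is a partial order with a least element in which every directed set has a supremum; a function between CPOs is continuous if it maps directed sets to directed sets and preserves their suprema; products of CPOs are ordered componentwise. For an ordinal $\zeta$, $\mathrm{On}(\zeta)$ is the set of ordinals $\le\zeta$ with the usual order. A sized CPO is a tuple $\langle\mathbb{A},\zeta,s,\mathtt{cut}\rangle$ where $\mathbb{A}$ is a CPO, $\zeta$ an ordinal (the size ordinal), $s:\mathbb{A}\to\mathrm{On}(\zeta)$ (size function) and $\mathtt{cut}:\mathrm{On}(\zeta)\times\mathbb{A}\to\mathbb{A}$, such that for $x\in\mathbb{A}$, $\alpha\le\zeta$: $s$ is surjective and continuous; $s(x)=\zeta$ iff $x$ is maximal in $\mathbb{A}$; $\mathtt{cut}$ is monotone in both arguments; $s(\mathtt{cut}(\alpha,x))=\alpha$ if $s(x)>\alpha$; $\mathtt{cut}(\alpha,x)=x$ if $s(x)\le\alpha$. A function between CPOs is regular if it is monotone and maps maximal elements to maximal elements. Given sized CPOs $\mathbb{A}_1,\ldots,\mathbb{A}_k,\mathbb{B}$ with sets of maximal elements $A_1,\ldots,A_k,B$, a production function for $f:A_1\times\cdots\times A_k\to B$ is any function $\eta:\mathrm{On}(\zeta_{\mathbb{A}_1})\times\cdots\times\mathrm{On}(\zeta_{\mathbb{A}_k})\to\mathrm{On}(\zeta_{\mathbb{B}})$ such that there is a regular $f^*:\mathbb{A}_1\times\cdots\times\mathbb{A}_k\to\mathbb{B}$ extending $f$ with $\eta(s(x_1),\ldots,s(x_k))=s(f^*(x_1,\ldots,x_k))$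 for all $x_i\in\mathbb{A}_i$. A function $f:S\to Q$ is defined by corecursion from $h:S\times Q^m\to Q$ and $g_i:S\to S$ if it is the unique function in $Q^S$ satisfying $f(x)=h(x,f(g_1(x)),\ldots,f(g_m(x)))$ for all $x\in S$. -}

module Defs where

open import Level using (Level; suc)
import Algebra.Construct.NaturalChoice.Min as Min
open import Data.Fin.Base using (Fin)
open import Data.Nat.Base using (ℕ)
open import Data.Product.Base using (Σ-syntax; ∃; _×_; proj₁)
open import Data.Sum.Base using (_⊎_; [_,_])
open import Data.Vec.Functional using (foldr)
open import Function.Base using (const)
open import Function.Bundles using (Func; _⟨$⟩_; _⇔_)
open import Function.Definitions using (Surjective)
open import Induction.WellFounded using (WellFounded)
open import Relation.Binary.Bundles
  using (Setoid; Poset; TotalOrder; DecTotalOrder; StrictTotalOrder)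
open import Relation.Binary.Core using (_Preserves_⟶_; _Preserves₂_⟶_⟶_)
open import Relation.Binary.Definitions using (Minimum)
import Relation.Binary.Construct.Add.Supremum.Strict as Supremum
import Relation.Binary.Construct.On as Restrict
open import Relation.Binary.Indexed.Homogeneous.Bundles
  using (IndexedSetoid; IndexedPoset)
import Relation.Binary.Properties.StrictTotalOrder as STO
open import Relation.Nullary.Construct.Add.Supremum using (⊤⁺)
open import Relation.Unary using (Pred; _∈_)

private
  variable
    ℓ : Level

-- Sets are setoids: a function is either a `Func`, or a bare function between
-- carriers on which a condition (monotonicity or continuity) is imposed from
-- which congruence follows.

------------------------------------------------------------------------
-- Products

Π-setoid : {I : Set} → (I → Setoid ℓ ℓ) → Setoid ℓ ℓ
Π-setoid {ℓ = ℓ} {I = I} S = IndexedSetoid.setoid indexed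
  where
  indexed : IndexedSetoid I ℓ ℓ
  indexed = record
    { Carrierᵢ       = λ i → Setoid.Carrier (S i)
    ; _≈ᵢ_           = λ {i} → Setoid._≈_ (S i)
    ; isEquivalenceᵢ = record
      { reflᵢ  = λ {i} → Setoid.refl (S i)
      ; symᵢ   = λ {i} → Setoid.sym (S i)
      ; transᵢ = λ {i} → Setoid.trans (S i)
      }
    }

Π-poset : {I : Set} → (I → Poset ℓ ℓ ℓ) → Poset ℓ ℓ ℓ
Π-poset {ℓ = ℓ} {I = I} P = IndexedPoset.poset indexed
  where
  indexed : IndexedPoset I ℓ ℓ ℓ
  indexed = record
    { Carrierᵢ        = λ i → Poset.Carrier (P i)
    ; _≈ᵢ_            = λ {i} → Poset._≈_ (P i)
    ; _≤ᵢ_            = λ {i} → Poset._≤_ (P i)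
    ; isPartialOrderᵢ = record
      { isPreorderᵢ = record
        { isEquivalenceᵢ = record
          { reflᵢ  = λ {i} → Poset.Eq.refl (P i)
          ; symᵢ   = λ {i} → Poset.Eq.sym (P i)
          ; transᵢ = λ {i} → Poset.Eq.trans (P i)
          }
        ; reflexiveᵢ = λ {i} → Poset.reflexive (P i)
        ; transᵢ     = λ {i} → Poset.trans (P i)
        }
      ; antisymᵢ = λ {i} → Poset.antisym (P i)
      }
    }

component : {I : Set} {S : Setoid ℓ ℓ} {T : I → Setoid ℓ ℓ} (i : I) →
            Func S (Π-setoid T) → Func S (T i)
component i f = record
  { to   = λ x → (f ⟨$⟩ x) i
  ; cong = λ x≈y → Func.cong f x≈y i
  }

------------------------------------------------------------------------
-- CPOs

module _ (P : Poset ℓ ℓ ℓ) where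
  open Poset P

  IsSupremum : Pred Carrier ℓ → Carrier → Set ℓ
  IsSupremum D x = (∀ y → y ∈ D → y ≤ x) × (∀ z → (∀ y → y ∈ D → y ≤ z) → x ≤ z)

  Directed : Pred Carrier ℓ → Set ℓ
  Directed D = ∃ D × (∀ x y → x ∈ D → y ∈ D → ∃ λ z → z ∈ D × x ≤ z × y ≤ z)

  Maximal : Carrier → Set ℓ
  Maximal x = ∀ y → x ≤ y → y ≈ x

  MaximalElements : Setoid ℓ ℓ
  MaximalElements = Restrict.setoid {B = ∃ Maximal} Eq.setoid proj₁

record CPO (ℓ : Level) : Set (suc ℓ) where
  field
    poset    : Poset ℓ ℓ ℓ
  open Poset poset public
  field
    ⊥        : Carrier
    ⊥-least  : Minimum _≤_ ⊥
    supremum : ∀ D → Directed poset D → ∃ (IsSupremum poset D)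

module _ (P Q : Poset ℓ ℓ ℓ) where
  private
    module P = Poset P
    module Q = Poset Q

  Image : (P.Carrier → Q.Carrier) → Pred P.Carrier ℓ → Pred Q.Carrier ℓ
  Image f D y = ∃ λ x → x ∈ D × f x Q.≈ y

  Continuous : (P.Carrier → Q.Carrier) → Set (suc ℓ)
  Continuous f = ∀ D → Directed P D →
    Directed Q (Image f D) ×
    (∀ x → IsSupremum P D x → IsSupremum Q (Image f D) (f x))

  Regular : (P.Carrier → Q.Carrier) → Set ℓ
  Regular f =
    f Preserves P._≤_ ⟶ Q._≤_ ×
    (∀ x → Maximal P x → Maximal Q (f x))

------------------------------------------------------------------------
-- Ordinals

-- An ordinal is represented by a well-order whose order type it is.

record Ordinal (ℓ : Level) : Set (suc ℓ) where
  field
    strictTotalOrder : StrictTotalOrder ℓ ℓ ℓ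
  open StrictTotalOrder strictTotalOrder public
  field
    <-wellFounded    : WellFounded _<_

-- The ordinals below ζ correspond to the elements of a well-order of type ζ, so
-- On ζ is obtained by adding a greatest element ⊤⁺, which stands for ζ itself.

module On (ζ : Ordinal ℓ) where

  strictTotalOrder : StrictTotalOrder ℓ ℓ ℓ
  strictTotalOrder = record
    { isStrictTotalOrder =
        Supremum.<⁺-isStrictTotalOrder (Ordinal._<_ ζ) (Ordinal.isStrictTotalOrder ζ)
    }

  open StrictTotalOrder strictTotalOrder public
    using (Carrier; _<_; _≈_; module Eq)

  totalOrder : TotalOrder ℓ ℓ ℓ
  totalOrder = DecTotalOrder.totalOrder (STO.decTotalOrder strictTotalOrder)

  open TotalOrder totalOrder public using (_≤_; poset)

  setoid : Setoid ℓ ℓ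
  setoid = Poset.Eq.setoid poset

  -- ⊤⁺ is neutral for _⊓_, so this is the ordinary minimum of a nonempty family.
  min : ∀ {m} → (Fin m → Carrier) → Carrier
  min = foldr (Min._⊓_ totalOrder) ⊤⁺

------------------------------------------------------------------------
-- Sized CPOs

record SizedCPO (ℓ : Level) : Set (suc ℓ) where
  field
    cpo : CPO ℓ
    ζ   : Ordinal ℓ
  open CPO cpo public
  module Size = On ζ
  field
    s              : Carrier → Size.Carrier
    cut            : Size.Carrier → Carrier → Carrier
    s-surjective   : Surjective _≈_ Size._≈_ s
    s-continuous   : Continuous poset Size.poset s
    s≈ζ⇔maximal    : ∀ x → s x Size.≈ ⊤⁺ ⇔ Maximal poset x
    cut-monotone   : cut Preserves₂ Size._≤_ ⟶ _≤_ ⟶ _≤_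
    s-cut          : ∀ α x → α Size.< s x → s (cut α x) Size.≈ α
    cut-idle       : ∀ α x → s x Size.≤ α → cut α x ≈ x

  max : Setoid ℓ ℓ
  max = MaximalElements poset

open SizedCPO public using (max)

Size : SizedCPO ℓ → Set ℓ
Size 𝔸 = SizedCPO.Size.Carrier 𝔸

infix 4 size-< size-≈

size-< size-≈ : (𝔸 : SizedCPO ℓ) → Size 𝔸 → Size 𝔸 → Set ℓ
size-< 𝔸 = SizedCPO.Size._<_ 𝔸
size-≈ 𝔸 = SizedCPO.Size._≈_ 𝔸

syntax size-< 𝔸 α β = α <[ 𝔸 ] β
syntax size-≈ 𝔸 α β = α ≈[ 𝔸 ] β

minSize : (𝔸 : SizedCPO ℓ) → ∀ {m} → (Fin m → Size 𝔸) → Size 𝔸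
minSize 𝔸 = SizedCPO.Size.min 𝔸

module _ {I : Set} (𝔸 : I → SizedCPO ℓ) where

  Π-max : Setoid ℓ ℓ
  Π-max = Π-setoid λ i → SizedCPO.max (𝔸 i)

  Π-size : Poset ℓ ℓ ℓ
  Π-size = Π-poset λ i → SizedCPO.Size.poset (𝔸 i)

  SizeFunction : SizedCPO ℓ → Set ℓ
  SizeFunction 𝔹 = Func (Poset.Eq.setoid Π-size) (SizedCPO.Size.setoid 𝔹)

  ContinuousSizeFunction : (𝔹 : SizedCPO ℓ) → SizeFunction 𝔹 → Set (suc ℓ)
  ContinuousSizeFunction 𝔹 η = Continuous Π-size (SizedCPO.Size.poset 𝔹) (η ⟨$⟩_)

  IsProductionFunction : (𝔹 : SizedCPO ℓ) →
                         Func Π-max (SizedCPO.max 𝔹) → SizeFunction 𝔹 → Set ℓ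
  IsProductionFunction 𝔹 f η =
    Σ[ f* ∈ (Poset.Carrier Π𝔸 → 𝔹.Carrier) ]
      Regular Π𝔸 𝔹.poset f* ×
      (∀ x → f* (λ i → proj₁ (x i)) 𝔹.≈ proj₁ (f ⟨$⟩ x)) ×
      (∀ x → η ⟨$⟩ (λ i → SizedCPO.s (𝔸 i) (x i)) 𝔹.Size.≈ 𝔹.s (f* x))
    where
    module 𝔹 = SizedCPO 𝔹
    Π𝔸 = Π-poset λ i → SizedCPO.poset (𝔸 i)

-- The family 𝔸₁, …, 𝔸ₙ, 𝔹, …, 𝔹 with m copies of 𝔹; its tuples are written
-- [ x , y ] with x a tuple over 𝔸 and y an m-tuple over 𝔹.

_▷_^_ : ∀ {n} → (Fin n → SizedCPO ℓ) → SizedCPO ℓ → (m : ℕ) →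
        Fin n ⊎ Fin m → SizedCPO ℓ
𝔸 ▷ 𝔹 ^ m = [ 𝔸 , const 𝔹 ]

------------------------------------------------------------------------
-- Corecursion

module _ (S Q : Setoid ℓ ℓ) {m : ℕ}
         (h : Setoid.Carrier S → (Fin m → Setoid.Carrier Q) → Setoid.Carrier Q)
         (g : Fin m → Setoid.Carrier S → Setoid.Carrier S) where
  open Setoid Q using (_≈_)

  SatisfiesCorecursion : Func S Q → Set ℓ
  SatisfiesCorecursion f = ∀ x → f ⟨$⟩ x ≈ h x (λ i → f ⟨$⟩ g i x)

  IsDefinedByCorecursion : Func S Q → Set ℓ
  IsDefinedByCorecursion f =
    SatisfiesCorecursion f ×
    (∀ f′ → SatisfiesCorecursion f′ → ∀ x → f′ ⟨$⟩ x ≈ f ⟨$⟩ x)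

{-# OPTIONS --safe #-}

-- The operator k ↦ h*(x, k(g₁* x), …, kₘ(gₘ* x)) on monotone maps has a fixed
-- point f* that arises from the least map by iteration with directed suprema.
-- Since s is continuous, "the size of k x depends only on the sizes of x" is
-- inherited along the iteration, and so is continuity of the induced function on
-- sizes. At maximal arguments the size β of f* satisfies β = ηₕ(ζ, β, …, β),
-- which the hypothesis on ηₕ excludes unless β = ζ (for m = 0, β = ζ because h* is
-- regular). Hence f* restricts to maximal elements, where it satisfies the
-- corecursive equation and so agrees with f.

module Submission where

open import Level using (Level; suc)
import Algebra.Construct.NaturalChoice.Min as Min
open import Axiom.ExcludedMiddle using (ExcludedMiddle)
open import Data.Empty using (⊥-elim)
open import Data.Fin.Base using (Fin; zero)
import Data.Fin.Properties as Fin
open import Data.Nat.Base using (ℕ)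
open import Data.Product.Base using (Σ-syntax; ∃; _×_; _,_; proj₁; proj₂)
open import Data.Sum.Base using (_⊎_; inj₁; inj₂; [_,_]; [_,_]′)
open import Function.Base using (_∘_; const; id)
open import Function.Bundles using (Func; _⟨$⟩_; Equivalence)
open import Relation.Binary.Bundles using (Poset; StrictTotalOrder)
open import Relation.Binary.Construct.Add.Supremum.Equality using (⊤⁺≈⊤⁺)
open import Relation.Binary.Construct.Add.Supremum.Strict using ([_]<⊤⁺)
open import Relation.Binary.Core using (_Preserves_⟶_)
open import Relation.Binary.Definitions using (DecidableEquality)
open import Relation.Binary.PropositionalEquality.Core using (_≡_; refl; subst)
open import Relation.Nullary.Construct.Add.Supremum as Supremum using (⊤⁺)
open import Relation.Nullary.Decidable.Core using (Dec; yes; no; True; toWitness; fromWitness)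
open import Relation.Nullary.Negation.Core using (¬_)
open import Relation.Unary using (Pred; _∈_)
open import Defs

-- Monotone and continuous maps between posets.

module _ {ℓ : Level} {P Q : Poset ℓ ℓ ℓ} where
  private
    module P = Poset P
    module Q = Poset Q

  monotone⇒cong : ∀ {f} → f Preserves P._≤_ ⟶ Q._≤_ → f Preserves P._≈_ ⟶ Q._≈_
  monotone⇒cong mono x≈y =
    Q.antisym (mono (P.reflexive x≈y)) (mono (P.reflexive (P.Eq.sym x≈y)))

  monotone⇒directed : ∀ {f D} → f Preserves P._≤_ ⟶ Q._≤_ →
                      Directed P D → Directed Q (Image P Q f D)
  monotone⇒directed {f} mono ((d , d∈D) , bound) =
    (f d , d , d∈D , Q.Eq.refl) , λ where
      _ _ (x , x∈D , fx≈u) (y , y∈D , fy≈v) →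
        let z , z∈D , x≤z , y≤z = bound x y x∈D y∈D
        in f z , (z , z∈D , Q.Eq.refl) , Q.≤-respˡ-≈ fx≈u (mono x≤z) , Q.≤-respˡ-≈ fy≈v (mono y≤z)

  image-bound : ∀ {f D z} → (∀ y → y ∈ D → f y Q.≤ z) → ∀ u → u ∈ Image P Q f D → u Q.≤ z
  image-bound bound u (y , y∈D , fy≈u) = Q.≤-respˡ-≈ fy≈u (bound y y∈D)

  -- If x ≤ y, the pair of x and y is directed with supremum y, so `f y` is the supremum of a set
  -- that contains `f x`.
  continuous⇒monotone : ∀ {f} → Continuous P Q f → f Preserves P._≤_ ⟶ Q._≤_
  continuous⇒monotone {f} cont {x} {y} x≤y =
    proj₁ (proj₂ (cont pair directed) y sup) (f x) (x , inj₁ P.Eq.refl , Q.Eq.refl)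
    where
    pair : Pred P.Carrier ℓ
    pair z = z P.≈ x ⊎ z P.≈ y

    below : ∀ z → z ∈ pair → z P.≤ y
    below z (inj₁ z≈x) = P.≤-respˡ-≈ (P.Eq.sym z≈x) x≤y
    below z (inj₂ z≈y) = P.reflexive z≈y

    directed : Directed P pair
    directed = (x , inj₁ P.Eq.refl) ,
      λ u v u∈ v∈ → y , inj₂ P.Eq.refl , below u u∈ , below v v∈

    sup : IsSupremum P pair y
    sup = below , λ z bound → bound y (inj₂ P.Eq.refl)

  -- The part of continuity that monotonicity does not supply, phrased through bounds on the values
  -- `f y` so that images need not be handled.
  SubpreservesSuprema : (P.Carrier → Q.Carrier) → Set (suc ℓ)
  SubpreservesSuprema f = ∀ D → Directed P D → ∀ x → IsSupremum P D x →
    ∀ z → (∀ y → y ∈ D → f y Q.≤ z) → f x Q.≤ z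

  continuous⇒subpreserves : ∀ {f} → Continuous P Q f → SubpreservesSuprema f
  continuous⇒subpreserves cont D dir x sup z bound =
    proj₂ (proj₂ (cont D dir) x sup) z (image-bound bound)

  continuous : ∀ {f} → f Preserves P._≤_ ⟶ Q._≤_ → SubpreservesSuprema f → Continuous P Q f
  continuous mono sub D dir = monotone⇒directed mono dir , λ x sup →
    image-bound (λ y y∈D → mono (proj₁ sup y y∈D)) ,
    λ z bound → sub D dir x sup z (λ y y∈D → bound _ (y , y∈D , Q.Eq.refl))

  continuous-resp-≈ : ∀ {f f′} → (∀ x → f x Q.≈ f′ x) → Continuous P Q f → Continuous P Q f′
  continuous-resp-≈ {f} {f′} f≈f′ cont = continuous
    (λ x≤y → Q.≤-respˡ-≈ (f≈f′ _) (Q.≤-respʳ-≈ (f≈f′ _) (continuous⇒monotone cont x≤y)))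
    λ D dir x sup z bound → Q.≤-respˡ-≈ (f≈f′ x) (continuous⇒subpreserves cont D dir x sup z
      λ y y∈D → Q.≤-respˡ-≈ (Q.Eq.sym (f≈f′ y)) (bound y y∈D))

module _ {ℓ : Level} {P Q R : Poset ℓ ℓ ℓ} where

  continuous-∘ : ∀ {f g} → Continuous Q R g → Continuous P Q f → Continuous P R (g ∘ f)
  continuous-∘ {f} {g} contg contf = continuous {P = P} {R}
    (monog ∘ continuous⇒monotone {P = P} {Q} contf)
    λ D dir x sup z bound →
      continuous⇒subpreserves {P = Q} {R} contg _ (proj₁ (contf D dir)) (f x) (proj₂ (contf D dir) x sup) z
        λ { u (y , y∈D , fy≈u) →
            Poset.trans R (monog (Poset.reflexive Q (Poset.Eq.sym Q fy≈u))) (bound y y∈D) }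
    where
    monog : g Preserves Poset._≤_ Q ⟶ Poset._≤_ R
    monog = continuous⇒monotone {P = Q} {R} contg

-- Products: tuples, change of one coordinate, projections.

module _ {ℓ : Level} {P : Poset ℓ ℓ ℓ} where

  module _ {I : Set} {Q : I → Poset ℓ ℓ ℓ} where

    continuous-tuple : {f : Poset.Carrier P → Poset.Carrier (Π-poset Q)} →
      (∀ i → Continuous P (Q i) (λ x → f x i)) → Continuous P (Π-poset Q) f
    continuous-tuple cont = continuous {P = P} {Π-poset Q}
      (λ x≤y i → continuous⇒monotone {P = P} {Q i} (cont i) x≤y)
      λ D dir x sup z bound i →
        continuous⇒subpreserves {P = P} {Q i} (cont i) D dir x sup (z i) (λ y y∈D → bound y y∈D i)

module Update {ℓ : Level} {I : Set} (_≟_ : DecidableEquality I) {A : I → Set ℓ}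
              (x : ∀ j → A j) (i : I) (a : A i) where

  private
    choose : ∀ {j} → Dec (i ≡ j) → A j
    choose     (yes refl) = a
    choose {j} (no _)     = x j

  updated : ∀ j → A j
  updated j = choose (i ≟ j)

  updated-at : updated i ≡ a
  updated-at with i ≟ i
  ... | yes refl = refl
  ... | no i≢i   = ⊥-elim (i≢i refl)

  updated-all : (R : ∀ j → A j → Set ℓ) → R i a → (∀ j → R j (x j)) → ∀ j → R j (updated j)
  updated-all R Ra Rx j with i ≟ j
  ... | yes refl = Ra
  ... | no _     = Rx j

module _ {ℓ : Level} {I : Set} (P : I → Poset ℓ ℓ ℓ) where
  private
    module P i = Poset (P i)

  components-maximal⇒maximal : ∀ {x} → (∀ i → Maximal (P i) (x i)) → Maximal (Π-poset P) x
  components-maximal⇒maximal max y x≤y i = max i (y i) (x≤y i)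

  module _ (_≟_ : DecidableEquality I) where

    -- Raising coordinate `i` alone to `y` gives a tuple above `x`; maximality makes the two equal,
    -- in particular at `i`.
    maximal⇒component-maximal : ∀ {x} → Maximal (Π-poset P) x → ∀ i → Maximal (P i) (x i)
    maximal⇒component-maximal {x} max i y x≤y =
      subst (λ u → P._≈_ i u (x i)) updated-at
        (max updated (updated-all (λ j → P._≤_ j (x j)) x≤y (λ j → P.refl j)) i)
      where open Update _≟_ x i y

    -- If `z` bounds the i-th coordinates of `D`, then `x` with coordinate `i` replaced by `z` still
    -- bounds `D`, so `x` lies below it.
    continuous-projection : ∀ i → Continuous (Π-poset P) (P i) (λ x → x i)
    continuous-projection i = continuous {P = Π-poset P} {P i} (λ x≤y → x≤y i)
      λ D dir x (upper , least) z bound →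
        let open Update _≟_ x i z in
        subst (P._≤_ i (x i)) updated-at (least updated
          (λ y y∈D → updated-all (λ j → P._≤_ j (y j)) (bound y y∈D) (upper y y∈D)) i)

-- Fixed points

module _ {ℓ : Level} (em : ExcludedMiddle (suc ℓ)) (X : CPO ℓ) where
  open CPO X hiding (refl)

  -- Pataraia's argument: the pointwise supremum M of all monotone inflationary
  -- maps φ on the admissible post-fixed points is itself such a map, so F ∘ M ≤ M.
  -- Excluded middle turns the large predicate Adm into a small one, so that
  -- these maps range over a set of level ℓ.
  fixedPoint : (F : Carrier → Carrier) → F Preserves _≤_ ⟶ _≤_ →
    (Adm : Pred Carrier (suc ℓ)) →
    Adm ⊥ → (∀ x → Adm x → Adm (F x)) →
    (∀ D (dir : Directed poset D) → (∀ x → x ∈ D → Adm x) → Adm (proj₁ (supremum D dir))) →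
    ∃ λ x → x ≈ F x × Adm x
  fixedPoint F mono Adm adm-⊥ adm-F adm-sup =
    proj₁ t , antisym (proj₁ (proj₂ t)) Ft≤t , toWitness (proj₂ (proj₂ t))
    where
    PostFixed : Set ℓ
    PostFixed = Σ[ x ∈ Carrier ] x ≤ F x × True (em {Adm x})

    _≼_ : PostFixed → PostFixed → Set ℓ
    x ≼ y = proj₁ x ≤ proj₁ y

    Inflation : Set ℓ
    Inflation = Σ[ φ ∈ (PostFixed → PostFixed) ] φ Preserves _≼_ ⟶ _≼_ × (∀ x → x ≼ φ x)

    F̂ : PostFixed → PostFixed
    F̂ (x , x≤Fx , adm) = F x , mono x≤Fx , fromWitness (adm-F x (toWitness adm))

    Orbit : PostFixed → Pred Carrier ℓ
    Orbit x y = Σ[ φ ∈ Inflation ] y ≡ proj₁ (proj₁ φ x)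

    orbit-directed : ∀ x → Directed poset (Orbit x)
    orbit-directed x = (proj₁ x , (id , id , λ _ → reflexive Eq.refl) , refl) , λ where
        _ _ ((φ , φ-mono , φ-infl) , refl) ((ψ , ψ-mono , ψ-infl) , refl) →
          -- The composite lies above φ because ψ is inflationary and φ monotone, and above ψ
          -- because φ is inflationary.
          _ , ((φ ∘ ψ , φ-mono ∘ ψ-mono , λ y → trans (ψ-infl y) (φ-infl (ψ y))) , refl) ,
          φ-mono (ψ-infl x) , φ-infl (ψ x)

    M₀ : PostFixed → Carrier
    M₀ x = proj₁ (supremum (Orbit x) (orbit-directed x))

    M₀-upper : ∀ x (φ : Inflation) → proj₁ (proj₁ φ x) ≤ M₀ x
    M₀-upper x φ = proj₁ (proj₂ (supremum (Orbit x) (orbit-directed x))) _ (φ , refl)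

    M₀-least : ∀ x z → (∀ (φ : Inflation) → proj₁ (proj₁ φ x) ≤ z) → M₀ x ≤ z
    M₀-least x z bound =
      proj₂ (proj₂ (supremum (Orbit x) (orbit-directed x))) z λ { _ (φ , refl) → bound φ }

    M : PostFixed → PostFixed
    M x = M₀ x ,
      -- Post-fixedness passes to the supremum: φ x ≤ F (φ x) ≤ F (M₀ x) for every φ.
      M₀-least x _ (λ φ → trans (proj₁ (proj₂ (proj₁ φ x))) (mono (M₀-upper x φ))) ,
      fromWitness (adm-sup (Orbit x) (orbit-directed x)
        λ { _ (φ , refl) → toWitness (proj₂ (proj₂ (proj₁ φ x))) })

    M-monotone : M Preserves _≼_ ⟶ _≼_
    M-monotone {x} {y} x≼y =
      M₀-least x _ λ φ → trans (proj₁ (proj₂ φ) x≼y) (M₀-upper y φ)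

    M-inflationary : ∀ x → x ≼ M x
    M-inflationary x = M₀-upper x (id , id , λ _ → reflexive Eq.refl)

    t : PostFixed
    t = M (⊥ , ⊥-least (F ⊥) , fromWitness adm-⊥)

    Ft≤t : F (proj₁ t) ≤ proj₁ t
    Ft≤t = M₀-upper _ (F̂ ∘ M , mono ∘ M-monotone ,
      λ x → trans (M-inflationary x) (proj₁ (proj₂ (M x))))

-- The CPO of monotone maps with the pointwise order.

module _ {ℓ : Level} (P : Poset ℓ ℓ ℓ) (Y : CPO ℓ) where
  private
    module P = Poset P
    module Y = CPO Y

  MonotoneMap : Set ℓ
  MonotoneMap = Σ[ f ∈ (P.Carrier → Y.Carrier) ] f Preserves P._≤_ ⟶ Y._≤_

  monotoneMaps : Poset ℓ ℓ ℓ
  monotoneMaps = record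
    { Carrier = MonotoneMap
    ; _≈_     = λ f g → ∀ x → proj₁ f x Y.≈ proj₁ g x
    ; _≤_     = λ f g → ∀ x → proj₁ f x Y.≤ proj₁ g x
    ; isPartialOrder = record
      { isPreorder = record
        { isEquivalence = record
          { refl  = λ x → Y.Eq.refl
          ; sym   = λ f≈g x → Y.Eq.sym (f≈g x)
          ; trans = λ f≈g g≈h x → Y.Eq.trans (f≈g x) (g≈h x)
          }
        ; reflexive = λ f≈g x → Y.reflexive (f≈g x)
        ; trans     = λ f≤g g≤h x → Y.trans (f≤g x) (g≤h x)
        }
      ; antisym = λ f≤g g≤f x → Y.antisym (f≤g x) (g≤f x)
      }
    }

  ValuesAt : Pred MonotoneMap ℓ → P.Carrier → Pred Y.Carrier ℓ
  ValuesAt D x = Image monotoneMaps Y.poset (λ f → proj₁ f x) D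

  valuesAt-directed : ∀ {D} → Directed monotoneMaps D → ∀ x → Directed Y.poset (ValuesAt D x)
  valuesAt-directed dir x =
    monotone⇒directed {P = monotoneMaps} {Y.poset} (λ f≤g → f≤g x) dir

  pointwiseSupremum : ∀ D → Directed monotoneMaps D → ∃ (IsSupremum monotoneMaps D)
  pointwiseSupremum D dir = (value , value-monotone) ,
    upper , λ g bound x → least x _ (λ f f∈D → bound f f∈D x)
    where
    value : P.Carrier → Y.Carrier
    value x = proj₁ (Y.supremum (ValuesAt D x) (valuesAt-directed dir x))

    upper : ∀ f → f ∈ D → ∀ x → proj₁ f x Y.≤ value x
    upper f f∈D x =
      proj₁ (proj₂ (Y.supremum _ (valuesAt-directed dir x))) _ (f , f∈D , Y.Eq.refl)

    least : ∀ x z → (∀ f → f ∈ D → proj₁ f x Y.≤ z) → value x Y.≤ z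
    least x z bound =
      proj₂ (proj₂ (Y.supremum _ (valuesAt-directed dir x))) z
        (image-bound {P = monotoneMaps} {Y.poset} bound)

    value-monotone : value Preserves P._≤_ ⟶ Y._≤_
    value-monotone {x} {y} x≤y =
      least x _ λ f f∈D → Y.trans (proj₂ f x≤y) (upper f f∈D y)

  monotoneMapCPO : CPO ℓ
  monotoneMapCPO = record
    { poset    = monotoneMaps
    ; ⊥        = const Y.⊥ , λ _ → Y.reflexive Y.Eq.refl
    ; ⊥-least  = λ f x → Y.⊥-least (proj₁ f x)
    ; supremum = pointwiseSupremum
    }

-- Sized CPOs

module OnProperties {ℓ : Level} (ζ : Ordinal ℓ) where
  open On ζ
  open Min totalOrder using (⊓-glb)
  private
    module ≤ = Poset poset

  ≤⊤⁺ : ∀ α → α ≤ ⊤⁺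
  ≤⊤⁺ Supremum.[ α ] = inj₁ [ α ]<⊤⁺
  ≤⊤⁺ ⊤⁺             = inj₂ ⊤⁺≈⊤⁺

  -- Only an inequality, since the empty minimum is `⊤⁺`. It is meant for the hypothesis on ηₕ at a
  -- constant family.
  ≤-min-const : ∀ m β → β ≤ min {m} (const β)
  ≤-min-const ℕ.zero    β = ≤⊤⁺ β
  ≤-min-const (ℕ.suc m) β = ⊓-glb (≤.reflexive ≤.Eq.refl) (≤-min-const m β)

  ≤⇒≯ : ∀ {α β} → α ≤ β → β < α → ∀ {a} {A : Set a} → A
  ≤⇒≯ α≤β β<α = ⊥-elim (irrefl Eq.refl (<-≤-trans β<α α≤β))
    where
    open StrictTotalOrder strictTotalOrder using (irrefl; trans; <-respʳ-≈)

    <-≤-trans : ∀ {α β γ} → α < β → β ≤ γ → α < γ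
    <-≤-trans α<β (inj₁ β<γ) = trans α<β β<γ
    <-≤-trans α<β (inj₂ β≈γ) = <-respʳ-≈ β≈γ α<β

module SizedCPOProperties {ℓ : Level} (𝔸 : SizedCPO ℓ) where
  open SizedCPO 𝔸
  open OnProperties ζ public

  s-monotone : s Preserves _≤_ ⟶ Size._≤_
  s-monotone = continuous⇒monotone {P = poset} {Size.poset} s-continuous

  s-cong : s Preserves _≈_ ⟶ Size._≈_
  s-cong = monotone⇒cong {P = poset} {Size.poset} s-monotone

  withSize : Size.Carrier → Carrier
  withSize α = proj₁ (s-surjective α)

  s-withSize : ∀ α → s (withSize α) Size.≈ α
  s-withSize α = proj₂ (s-surjective α) Eq.refl

  maximal⇒⊤⁺ : ∀ {x} → Maximal poset x → s x Size.≈ ⊤⁺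
  maximal⇒⊤⁺ = Equivalence.from (s≈ζ⇔maximal _)

  ⊤⁺⇒maximal : ∀ {x} → s x Size.≈ ⊤⁺ → Maximal poset x
  ⊤⁺⇒maximal = Equivalence.to (s≈ζ⇔maximal _)

  -- Cutting at `⊤⁺` changes nothing, because every size is at most `⊤⁺`, and a smaller ordinal cuts
  -- to a smaller element.
  cut-≤ : ∀ α x → cut α x ≤ x
  cut-≤ α x = ≤-respʳ-≈ (cut-idle ⊤⁺ x (≤⊤⁺ (s x)))
                (cut-monotone (≤⊤⁺ α) (reflexive Eq.refl))

  -- Extends `s-cut` to the boundary case α = s x, where the cut is idle.
  s-cut-≤ : ∀ α x → α Size.≤ s x → s (cut α x) Size.≈ α
  s-cut-≤ α x (inj₁ α<sx) = s-cut α x α<sx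
  s-cut-≤ α x (inj₂ α≈sx) = Size.Eq.trans
    (s-cong (cut-idle α x (inj₂ (Size.Eq.sym α≈sx)))) (Size.Eq.sym α≈sx)

-- Size-respecting maps and the functions they induce on sizes.

module Sizes {ℓ : Level} {I : Set} (𝔸 : I → SizedCPO ℓ) (𝔹 : SizedCPO ℓ) where
  private
    module 𝔸 i = SizedCPO (𝔸 i)
    module 𝔸′ i = SizedCPOProperties (𝔸 i)
    module 𝔹 = SizedCPO 𝔹
    module 𝔹′ = SizedCPOProperties 𝔹

  Π𝔸 : Poset ℓ ℓ ℓ
  Π𝔸 = Π-poset λ i → 𝔸.poset i

  private
    module Π𝔸 = Poset Π𝔸
    module S = Poset (Π-size 𝔸)

  Maps : CPO ℓ
  Maps = monotoneMapCPO Π𝔸 𝔹.cpo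

  sizes : Π𝔸.Carrier → S.Carrier
  sizes x i = 𝔸.s i (x i)

  withSizes : S.Carrier → Π𝔸.Carrier
  withSizes α i = 𝔸′.withSize i (α i)

  sizes-withSizes : ∀ α → sizes (withSizes α) S.≈ α
  sizes-withSizes α i = 𝔸′.s-withSize i (α i)

  -- The condition for a map to factor through sizes: it makes `onSizes` independent of the
  -- representatives chosen by `withSizes`.
  RespectsSizes : MonotoneMap Π𝔸 𝔹.cpo → Set ℓ
  RespectsSizes (k , _) = ∀ x y → sizes x S.≈ sizes y → 𝔹.s (k x) 𝔹.Size.≈ 𝔹.s (k y)

  onSizes : MonotoneMap Π𝔸 𝔹.cpo → S.Carrier → 𝔹.Size.Carrier
  onSizes (k , _) α = 𝔹.s (k (withSizes α))

  onSizes-sizes : ∀ k → RespectsSizes k → ∀ x → onSizes k (sizes x) 𝔹.Size.≈ 𝔹.s (proj₁ k x)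
  onSizes-sizes k resp x = resp _ _ (sizes-withSizes (sizes x))

  -- withSizes need not be monotone, so the smaller sizes are realised by cutting
  -- the element that realises the larger ones.
  onSizes-monotone : ∀ k → RespectsSizes k → onSizes k Preserves S._≤_ ⟶ 𝔹.Size._≤_
  onSizes-monotone (k , mono) resp {α} {β} α≤β =
    Poset.≤-respˡ-≈ 𝔹.Size.poset (resp _ _ same-sizes)
      (𝔹′.s-monotone (mono λ i → 𝔸′.cut-≤ i _ _))
    where
    truncated : Π𝔸.Carrier
    truncated i = 𝔸.cut i (α i) (withSizes β i)

    same-sizes : sizes truncated S.≈ sizes (withSizes α)
    same-sizes = S.Eq.trans
      (λ i → 𝔸′.s-cut-≤ i _ _
        (Poset.≤-respʳ-≈ (𝔸.Size.poset i) (𝔸.Size.Eq.sym i (sizes-withSizes β i)) (α≤β i)))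
      (S.Eq.sym (sizes-withSizes α))

  sizeFunction : ∀ k → RespectsSizes k → SizeFunction 𝔸 𝔹
  sizeFunction k resp = record
    { to   = onSizes k
    ; cong = monotone⇒cong {P = Π-size 𝔸} {𝔹.Size.poset} (onSizes-monotone k resp)
    }

  module _ (D : Pred (MonotoneMap Π𝔸 𝔹.cpo) ℓ) (dir : Directed (CPO.poset Maps) D) where
    private
      k∞ : MonotoneMap Π𝔸 𝔹.cpo
      k∞ = proj₁ (CPO.supremum Maps D dir)

    -- Continuity of `s`, applied to the values at `x`. With `s-supremum-upper` it shows that the
    -- size of `k∞ x` is the supremum of the sizes of `k x` for `k` in `D`.
    s-supremum-least : ∀ x z → (∀ k → k ∈ D → 𝔹.s (proj₁ k x) 𝔹.Size.≤ z) →
                       𝔹.s (proj₁ k∞ x) 𝔹.Size.≤ z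
    s-supremum-least x z bound =
      continuous⇒subpreserves {P = 𝔹.poset} {𝔹.Size.poset} 𝔹.s-continuous
        (ValuesAt Π𝔸 𝔹.cpo D x) (valuesAt-directed Π𝔸 𝔹.cpo dir x) _
        (proj₂ (𝔹.supremum _ (valuesAt-directed Π𝔸 𝔹.cpo dir x))) z
        λ { u (k , k∈D , kx≈u) →
            Poset.≤-respˡ-≈ 𝔹.Size.poset (𝔹′.s-cong kx≈u) (bound k k∈D) }

    s-supremum-upper : ∀ x k → k ∈ D → 𝔹.s (proj₁ k x) 𝔹.Size.≤ 𝔹.s (proj₁ k∞ x)
    s-supremum-upper x k k∈D =
      𝔹′.s-monotone (proj₁ (proj₂ (CPO.supremum Maps D dir)) k k∈D x)

    supremum-respectsSizes : (∀ k → k ∈ D → RespectsSizes k) → RespectsSizes k∞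
    supremum-respectsSizes resp x y x≈y = Poset.antisym 𝔹.Size.poset
      (le x y x≈y) (le y x (S.Eq.sym {sizes x} {sizes y} x≈y))
      where
      le : ∀ x y → sizes x S.≈ sizes y → 𝔹.s (proj₁ k∞ x) 𝔹.Size.≤ 𝔹.s (proj₁ k∞ y)
      le x y x≈y = s-supremum-least x _ λ k k∈D →
        Poset.≤-respˡ-≈ 𝔹.Size.poset (𝔹.Size.Eq.sym (resp k k∈D x y x≈y))
          (s-supremum-upper y k k∈D)

    -- An interchange of suprema: a bound at the supremum of `E` is checked for each `k` in `D`,
    -- whose continuity reduces it to the members of `E`.
    supremum-continuousOnSizes : (∀ k → k ∈ D → RespectsSizes k) →
      (∀ k → k ∈ D → Continuous (Π-size 𝔸) 𝔹.Size.poset (onSizes k)) →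
      Continuous (Π-size 𝔸) 𝔹.Size.poset (onSizes k∞)
    supremum-continuousOnSizes resp cont = continuous {P = Π-size 𝔸} {𝔹.Size.poset}
      (onSizes-monotone k∞ (supremum-respectsSizes resp))
      λ E dirE α sup z bound → s-supremum-least _ z λ k k∈D →
        continuous⇒subpreserves {P = Π-size 𝔸} {𝔹.Size.poset} (cont k k∈D) E dirE α sup z
          λ y y∈E → Poset.trans 𝔹.Size.poset (s-supremum-upper _ k k∈D) (bound y y∈E)

-- The hypothesis on ηₕ speaks of an index below m, so the case m = 0 is treated apart.
fin? : ∀ m → Fin m ⊎ ¬ Fin m
fin? ℕ.zero    = inj₂ λ ()
fin? (ℕ.suc m) = inj₁ zero

-- The corecursion operator, its fixed point, and restriction to maximal elements.

module Corecursion {ℓ : Level} (em : ExcludedMiddle (suc ℓ))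
  (n m : ℕ) (𝔸 : Fin n → SizedCPO ℓ) (𝔹 : SizedCPO ℓ)
  (h : Func (Π-max (𝔸 ▷ 𝔹 ^ m)) (max 𝔹))
  (g : Fin m → Func (Π-max 𝔸) (Π-max 𝔸))
  (ηₕ : SizeFunction (𝔸 ▷ 𝔹 ^ m) 𝔹)
  (ηg : (i : Fin m) (j : Fin n) → SizeFunction 𝔸 (𝔸 j))
  (h-production : IsProductionFunction (𝔸 ▷ 𝔹 ^ m) 𝔹 h ηₕ)
  (g-production : ∀ i j → IsProductionFunction 𝔸 (𝔸 j) (component j (g i)) (ηg i j))
  (productive : ∀ (β : Fin m → Size 𝔹) → (∃ λ i → β i <[ 𝔹 ] ⊤⁺) →
                minSize 𝔹 β <[ 𝔹 ] (ηₕ ⟨$⟩ [ (λ j → ⊤⁺) , β ]))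
  where
  open Sizes 𝔸 𝔹
  module 𝔸 i = SizedCPO (𝔸 i)
  module 𝔸′ i = SizedCPOProperties (𝔸 i)
  module 𝔹 = SizedCPO 𝔹
  module 𝔹′ = SizedCPOProperties 𝔹
  module ηₕ = Func ηₕ
  module X = Poset Π𝔸
  module S = Poset (Π-size 𝔸)
  module β = Poset 𝔹.Size.poset

  h* : Poset.Carrier (Sizes.Π𝔸 (𝔸 ▷ 𝔹 ^ m) 𝔹) → 𝔹.Carrier
  h* = proj₁ h-production

  h*-mono : h* Preserves Poset._≤_ (Sizes.Π𝔸 (𝔸 ▷ 𝔹 ^ m) 𝔹) ⟶ 𝔹._≤_
  h*-mono = proj₁ (proj₁ (proj₂ h-production))

  g* : Fin m → X.Carrier → X.Carrier
  g* i x j = proj₁ (g-production i j) x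

  g*-mono : ∀ i → g* i Preserves X._≤_ ⟶ X._≤_
  g*-mono i x≤y j = proj₁ (proj₁ (proj₂ (g-production i j))) x≤y

  g*-max : ∀ i x → (∀ j → Maximal (𝔸.poset j) (x j)) → ∀ j → Maximal (𝔸.poset j) (g* i x j)
  g*-max i x max j = proj₂ (proj₁ (proj₂ (g-production i j))) x
    (components-maximal⇒maximal (λ i → 𝔸.poset i) max)

  g*-extends : ∀ i (x : ∀ j → ∃ (Maximal (𝔸.poset j))) →
    g* i (λ j → proj₁ (x j)) X.≈ λ j → proj₁ ((g i ⟨$⟩ x) j)
  g*-extends i x j = proj₁ (proj₂ (proj₂ (g-production i j))) x

  ηg⟨_⟩ : Fin m → S.Carrier → S.Carrier
  ηg⟨ i ⟩ α j = ηg i j ⟨$⟩ α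

  ηg-cong : ∀ i {α β} → α S.≈ β → ηg⟨ i ⟩ α S.≈ ηg⟨ i ⟩ β
  ηg-cong i α≈β j = Func.cong (ηg i j) α≈β

  g*-size : ∀ i x → sizes (g* i x) S.≈ ηg⟨ i ⟩ (sizes x)
  g*-size i x j = 𝔸.Size.Eq.sym j (proj₂ (proj₂ (proj₂ (g-production i j))) x)

  Map : Set ℓ
  Map = MonotoneMap Π𝔸 𝔹.cpo

  args : Map → X.Carrier → Poset.Carrier (Sizes.Π𝔸 (𝔸 ▷ 𝔹 ^ m) 𝔹)
  args (k , _) x = [ x , (λ i → k (g* i x)) ]

  F : Map → Map
  F k = h* ∘ args k , λ x≤y → h*-mono λ where
    (inj₁ j) → x≤y j
    (inj₂ i) → proj₂ k (g*-mono i x≤y)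

  F-mono : F Preserves CPO._≤_ Maps ⟶ CPO._≤_ Maps
  F-mono k≤k′ x = h*-mono λ where
    (inj₁ j) → 𝔸.reflexive j (𝔸.Eq.refl j)
    (inj₂ i) → k≤k′ (g* i x)

  s-F : ∀ k x → 𝔹.s (proj₁ (F k) x) β.≈
        ηₕ.to [ sizes x , (λ i → 𝔹.s (proj₁ k (g* i x))) ]
  s-F k x = β.Eq.trans (β.Eq.sym (proj₂ (proj₂ (proj₂ h-production)) (args k x))) (ηₕ.cong λ where
    (inj₁ j) → 𝔸.Size.Eq.refl j
    (inj₂ i) → β.Eq.refl)

  -- The right-hand side of the required equation, with `onSizes k` in place of ηf.
  Ψ : Map → S.Carrier → 𝔹.Size.Carrier
  Ψ k α = ηₕ.to [ α , (λ i → onSizes k (ηg⟨ i ⟩ α)) ]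

  -- Applying `g* i` to the representative of α need not give the representative of `ηg⟨ i ⟩ α`, but
  -- both have the same sizes, which suffices for a map that respects sizes.
  onSizes-F : ∀ k → RespectsSizes k → ∀ α → onSizes (F k) α β.≈ Ψ k α
  onSizes-F k resp α = β.Eq.trans (s-F k _) (ηₕ.cong λ where
    (inj₁ j) → sizes-withSizes α j
    (inj₂ i) → resp _ _ (S.Eq.trans (g*-size i _) (S.Eq.trans (ηg-cong i (sizes-withSizes α))
                 (S.Eq.sym (sizes-withSizes (ηg⟨ i ⟩ α))))))

  F-respects : ∀ k → RespectsSizes k → RespectsSizes (F k)
  F-respects k resp x y x≈y = β.Eq.trans (s-F k x) (β.Eq.trans (ηₕ.cong λ where
      (inj₁ j) → x≈y j
      (inj₂ i) → resp _ _ (S.Eq.trans (g*-size i x)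
                   (S.Eq.trans (ηg-cong i x≈y) (S.Eq.sym (g*-size i y)))))
    (β.Eq.sym (s-F k y)))

  Continuousη : Set (suc ℓ)
  Continuousη = ContinuousSizeFunction (𝔸 ▷ 𝔹 ^ m) 𝔹 ηₕ ×
                (∀ i j → ContinuousSizeFunction 𝔸 (𝔸 j) (ηg i j))

  ContinuousOnSizes : Map → Set (suc ℓ)
  ContinuousOnSizes k = Continuous (Π-size 𝔸) 𝔹.Size.poset (onSizes k)

  Ψ-continuous : Continuousη → ∀ k → ContinuousOnSizes k →
                 Continuous (Π-size 𝔸) 𝔹.Size.poset (Ψ k)
  Ψ-continuous (ηₕ-cont , ηg-cont) k k-cont =
    continuous-∘ {P = Π-size 𝔸} {Π-size (𝔸 ▷ 𝔹 ^ m)} {𝔹.Size.poset} ηₕ-cont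
      (continuous-tuple {P = Π-size 𝔸} {Q = λ i → SizedCPO.Size.poset ((𝔸 ▷ 𝔹 ^ m) i)} λ where
        (inj₁ j) → continuous-projection (λ j → 𝔸.Size.poset j) Fin._≟_ j
        (inj₂ i) → continuous-∘ {P = Π-size 𝔸} {Π-size 𝔸} {𝔹.Size.poset} k-cont
                     (continuous-tuple {P = Π-size 𝔸} {Q = λ j → 𝔸.Size.poset j} (ηg-cont i)))

  -- Continuity enters as an implication, so that a single fixed point serves both the equation and
  -- the continuity claim.
  Admissible : Map → Set (suc ℓ)
  Admissible k = RespectsSizes k × (Continuousη → ContinuousOnSizes k)

  abstract
    fixed : ∃ λ k → CPO._≈_ Maps k (F k) × Admissible k
    fixed = fixedPoint em Maps F (λ {k} {k′} → F-mono {k} {k′}) Admissible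
      ((λ _ _ _ → β.Eq.refl) , λ _ → continuous {P = Π-size 𝔸} {𝔹.Size.poset} (λ _ → β.refl)
        -- A constant map passes this test because a directed set is inhabited.
        λ { D ((d , d∈D) , _) x sup z bound → bound d d∈D })
      (λ k (resp , cont) → F-respects k resp , λ η-cont →
        continuous-resp-≈ {P = Π-size 𝔸} {𝔹.Size.poset} (λ α → β.Eq.sym (onSizes-F k resp α))
          (Ψ-continuous η-cont k (cont η-cont)))
      λ D dir adm → supremum-respectsSizes D dir (λ k k∈D → proj₁ (adm k k∈D)) ,
        λ η-cont → supremum-continuousOnSizes D dir (λ k k∈D → proj₁ (adm k k∈D))
                     λ k k∈D → proj₂ (adm k k∈D) η-cont

  f* : Map
  f* = proj₁ fixed

  f*-fixed : ∀ x → proj₁ f* x 𝔹.≈ proj₁ (F f*) x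
  f*-fixed = proj₁ (proj₂ fixed)

  f*-adm : Admissible f*
  f*-adm = proj₂ (proj₂ fixed)

  f*-respects : RespectsSizes f*
  f*-respects = proj₁ f*-adm

  onSizes-f* : ∀ α → onSizes f* α β.≈ Ψ f* α
  onSizes-f* α = β.Eq.trans (𝔹′.s-cong (f*-fixed _)) (onSizes-F f* f*-respects α)

  f*-max : ∀ x → (∀ j → Maximal (𝔸.poset j) (x j)) → Maximal 𝔹.poset (proj₁ f* x)
  f*-max x max = 𝔹′.⊤⁺⇒maximal ([ if-positive , if-nullary ]′ (fin? m))
    where
    b : 𝔹.Size.Carrier
    b = 𝔹.s (proj₁ f* x)

    b-fixed : b β.≈ ηₕ.to [ (λ _ → ⊤⁺) , const b ]
    b-fixed = β.Eq.trans (𝔹′.s-cong (f*-fixed x)) (β.Eq.trans (s-F f* x) (ηₕ.cong λ where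
      (inj₁ j) → 𝔸′.maximal⇒⊤⁺ j (max j)
      -- Both `x` and `g* i x` are maximal, hence of the same sizes, so every recursive value has
      -- size `b` as well.
      (inj₂ i) → f*-respects _ _ λ j → 𝔸.Size.Eq.trans j
        (𝔸′.maximal⇒⊤⁺ j (g*-max i x max j)) (𝔸.Size.Eq.sym j (𝔸′.maximal⇒⊤⁺ j (max j)))))

    if-nullary : ¬ Fin m → b β.≈ ⊤⁺
    -- Without recursive arguments, all arguments of `h*` are maximal, and regularity applies.
    if-nullary ¬i = β.Eq.trans (𝔹′.s-cong (f*-fixed x)) (𝔹′.maximal⇒⊤⁺
      (proj₂ (proj₁ (proj₂ h-production)) (args f* x)
        (components-maximal⇒maximal (λ i → SizedCPO.poset ((𝔸 ▷ 𝔹 ^ m) i)) λ where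
          (inj₁ j) → max j
          (inj₂ i) → ⊥-elim (¬i i))))

    if-positive : Fin m → b β.≈ ⊤⁺
    if-positive i with 𝔹′.≤⊤⁺ b
    ... | inj₂ b≈⊤ = b≈⊤
    -- Here ηₕ(ζ, b, ..., b) = b ≤ min(b, ..., b), against the strict inequality of the hypothesis.
    ... | inj₁ b<⊤ = 𝔹′.≤⇒≯ (β.≤-respˡ-≈ b-fixed (𝔹′.≤-min-const m b))
                       (productive (const b) (i , b<⊤))

  f*-cong : ∀ {x y} → x X.≈ y → proj₁ f* x 𝔹.≈ proj₁ f* y
  f*-cong = monotone⇒cong {P = Π𝔸} {𝔹.poset} (proj₂ f*)

  f*-restricted : Func (Π-max 𝔸) (max 𝔹)
  f*-restricted = record
    { to   = λ x → proj₁ f* (λ j → proj₁ (x j)) , f*-max _ (λ j → proj₂ (x j))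
    ; cong = λ x≈y → f*-cong x≈y
    }

  restricted-satisfies : SatisfiesCorecursion (Π-max 𝔸) (max 𝔹)
    (λ x y → h ⟨$⟩ [ x , y ]) (λ i x → g i ⟨$⟩ x) f*-restricted
  restricted-satisfies x = 𝔹.Eq.trans (f*-fixed _) (𝔹.Eq.trans
    -- On maximal tuples `g*` agrees with `g` up to `_≈_`, so the recursive arguments are exchanged
    -- first; then `h*` is applied to maximal arguments only and equals `h`.
    (monotone⇒cong {P = Sizes.Π𝔸 (𝔸 ▷ 𝔹 ^ m) 𝔹} {𝔹.poset} h*-mono λ where
      (inj₁ j) → 𝔸.Eq.refl j
      (inj₂ i) → f*-cong (g*-extends i x))
    (proj₁ (proj₂ (proj₂ h-production)) [ x , (λ i → f*-restricted ⟨$⟩ (g i ⟨$⟩ x)) ]))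

theorem4p13 : ∀ {ℓ} → ExcludedMiddle (suc ℓ) →
    (n m : ℕ) (𝔸 : Fin n → SizedCPO ℓ) (𝔹 : SizedCPO ℓ) →
    (h : Func (Π-max (𝔸 ▷ 𝔹 ^ m)) (max 𝔹))
    (g : Fin m → Func (Π-max 𝔸) (Π-max 𝔸))
    (ηₕ : SizeFunction (𝔸 ▷ 𝔹 ^ m) 𝔹)
    (ηg : (i : Fin m) (j : Fin n) → SizeFunction 𝔸 (𝔸 j)) →
    IsProductionFunction (𝔸 ▷ 𝔹 ^ m) 𝔹 h ηₕ →
    (∀ i j → IsProductionFunction 𝔸 (𝔸 j) (component j (g i)) (ηg i j)) →
    (∀ (β : Fin m → Size 𝔹) → (∃ λ i → β i <[ 𝔹 ] ⊤⁺) →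
       minSize 𝔹 β <[ 𝔹 ] (ηₕ ⟨$⟩ [ (λ j → ⊤⁺) , β ])) →
    (f : Func (Π-max 𝔸) (max 𝔹)) →
    IsDefinedByCorecursion (Π-max 𝔸) (max 𝔹) (λ x y → h ⟨$⟩ [ x , y ]) (λ i x → g i ⟨$⟩ x) f →
    Σ[ ηf ∈ SizeFunction 𝔸 𝔹 ]
      IsProductionFunction 𝔸 𝔹 f ηf ×
      (∀ α → (ηf ⟨$⟩ α) ≈[ 𝔹 ]
             (ηₕ ⟨$⟩ [ α , (λ i → ηf ⟨$⟩ (λ j → ηg i j ⟨$⟩ α)) ])) ×
      (ContinuousSizeFunction (𝔸 ▷ 𝔹 ^ m) 𝔹 ηₕ →
       (∀ i j → ContinuousSizeFunction 𝔸 (𝔸 j) (ηg i j)) →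
       ContinuousSizeFunction 𝔸 𝔹 ηf)
theorem4p13 em n m 𝔸 𝔹 h g ηₕ ηg h-production g-production productive f (_ , f-unique) =
  sizeFunction f* f*-respects ,
  (proj₁ f* ,
    (proj₂ f* , λ x max →
      f*-max x (maximal⇒component-maximal (λ j → SizedCPO.poset (𝔸 j)) Fin._≟_ max)) ,
    -- Uniqueness of the corecursive solution makes `f*` an extension of the given `f`.
    f-unique f*-restricted restricted-satisfies ,
    onSizes-sizes f* f*-respects) ,
  onSizes-f* ,
  λ ηₕ-cont ηg-cont → proj₂ f*-adm (ηₕ-cont , ηg-cont)
  where
  open Sizes 𝔸 𝔹
  open Corecursion em n m 𝔸 𝔹 h g ηₕ ηg h-production g-production productive
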